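{- Let $T=(L,R,\tau,\sigma)$ be a rewrite rule and $m:L\to G$ a matching with respect to $T$. Let $(\mathcal{H},\tau_1,\delta)$ be a pushout of $\tau$ and $|m|$ in the category of sets ($\tau_1:|G|\to\mathcal{H}$, $\delta:|R|\to\mathcal{H}$, $\delta\circ\tau=\tau_1\circ|m|$), let $\Gamma=|G|-|m(L)|$, $\Sigma=\mathrm{dom}(\sigma)$, $\Delta=|R|-\Sigma$, and let $\sigma_1:\mathcal{H}\rightharpoonup|G|$ be the unique partial function with domain $\delta(\Sigma)$ such that $|m|\circ\sigma=\sigma_1\circ\delta$ on $\Sigma$. Let $H$ be the graph with set of nodes $\mathcal{H}$ determined by requiring that $\tau_1$ is strictly graphic on $\Gamma$, that $\delta$ is strictly graphic on $\Delta$, and that each node $n_1\in\delta(\Sigma)$ is a $\tau_1$-clone of $\sigma_1(n_1)$. Then $\delta$ underlies a graph morphism $d:R\to H$, and $(H,\tau_1,d,\sigma_1)$ is a cloning pushout of $T$ and $m$, i.e. an initial object of the category of cloning cones over $T$ and $m$.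
   Context: A signature $\Omega$ assigns an arity to each symbol; for a function $f$, $f^*$ acts letterwise on strings. A termgraph (graph) $G$ has node set $|G|$, a subset of labeled nodes, a labeling $\mathcal{L}_G$ of labeled nodes by symbols of $\Omega$ and a successor function $\mathcal{S}_G$ giving each labeled node a string of nodes of length the arity of its label. A graph morphism $g:G\to H$ is a function $|G|\to|H|$ sending labeled nodes to labeled nodes with $\mathcal{L}_H(g(n))=\mathcal{L}_G(n)$ and $\mathcal{S}_H(g(n))=g^*(\mathcal{S}_G(n))$ for each labeled $n$; $|g|$ is its underlying function. A function $\gamma:|G|\to|H|$ is graphic at a node $n$ if $n$ is unlabeled or both $n,\gamma(n)$ are labeled with $\mathcal{L}_H(\gamma(n))=\mathcal{L}_G(n)$, $\mathcal{S}_H(\gamma(n))=\gamma^*(\mathcal{S}_G(n))$; strictly graphic at $n$ if both $n,\gamma(n)$ are unlabeled or both are labeled with these equalities; (strictly) graphic on a set if so at each node of it. For $\tau:|G|\to|H|$, a node $p\in|H|$ is a $\tau$-clone of $q\in|G|$ if $p$ is labeled iff $q$ is, and then $\mathcal{L}_H(p)=\mathcal{L}_G(q)$ and $\mathcal{S}_H(p)=\tau^*(\mathcal{S}_G(q))$. A rewrite rule is $(L,R,\tau,\sigma)$ with $L,R$ graphs, $\tau:|L|\to|R|$ a function, $\sigma:|R|\rightharpoonup|L|$ a partial function such that each $n\in\mathrm{dom}(\sigma)$ is unlabeled or a $\tau$-clone of $\sigma(n)$. A morphism of rewrite rules $(L,R,\tau,\sigma)\to(L_1,R_1,\tau_1,\sigma_1)$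 is a pair of graph morphisms $m:L\to L_1$, $d:R\to R_1$ with $|d|\circ\tau=\tau_1\circ|m|$, $d(\mathrm{dom}(\sigma))\subseteq\mathrm{dom}(\sigma_1)$ and $|m|\circ\sigma=\sigma_1\circ|d|$ on $\mathrm{dom}(\sigma)$. A matching with respect to $T=(L,R,\tau,\sigma)$ is a graph morphism $m:L\to G$ such that whenever $m(p)=m(p')$ for distinct $p,p'\in|L|$, then $\tau(p),\tau(p')\in\mathrm{dom}(\sigma)$ and $\sigma(\tau(p))=\sigma(\tau(p'))$. A cloning cone over $T$ and $m:L\to G$ is a tuple $(H,\tau_1,d,\sigma_1)$ with $H$ a graph, $\tau_1:|G|\to|H|$ a function, $d:R\to H$ a graph morphism, $\sigma_1:|H|\rightharpoonup|G|$ a partial function, such that $(G,H,\tau_1,\sigma_1)$ is a rewrite rule, $(m,d)$ is a morphism of rewrite rules from $T$ to $(G,H,\tau_1,\sigma_1)$, $\tau_1$ is graphic on $|G|-|m(L)|$, and every $n_1\in\mathrm{dom}(\sigma_1)$ is a $\tau_1$-clone of $\sigma_1(n_1)$. A morphism of cloning cones $(H,\tau_1,d,\sigma_1)\to(H',\tau_1',d',\sigma_1')$ is a graph morphism $h:H\to H'$ with $|h|\circ\tau_1=\tau_1'$, $h\circ d=d'$, $h(\mathrm{dom}(\sigma_1))\subseteq\mathrm{dom}(\sigma_1')$ and $\sigma_1'\circ|h|=\sigma_1$ on $\mathrm{dom}(\sigma_1)$; this defines the category of cloning cones over $T$ and $m$. -}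

module Defs where

open import Level using (Level; _⊔_) renaming (suc to lsuc)
open import Data.Nat.Base using (ℕ)
open import Data.List.Base using (List; length; map)
open import Data.Product using (Σ-syntax; ∃; ∃!; _×_)
open import Data.Sum.Base using (_⊎_)
open import Function.Base using (_∘_)
open import Function.Bundles using (_⇔_)
open import Relation.Binary.PropositionalEquality using (_≡_; _≢_; _≗_)
open import Relation.Unary using (Pred; _∈_; _∉_; _⊆_; _≐_; ∁)

private
  variable
    o ℓ : Level

image : {A B : Set ℓ} → (A → B) → Pred A ℓ → Pred B ℓ
image f S b = ∃ λ a → a ∈ S × f a ≡ b

range : {A B : Set ℓ} → (A → B) → Pred B ℓ
range f b = ∃ λ a → f a ≡ b

-- Membership proofs are taken irrelevantly, so that a value depends only on the
-- element of the domain.  The same device is used for labels and successors.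
infix 4 _⇀_ _≈ₚ_
record _⇀_ (A B : Set ℓ) : Set (lsuc ℓ) where
  field
    dom   : Pred A ℓ
    apply : ∀ a → .(a ∈ dom) → B

open _⇀_ public

_≈ₚ_ : {A B : Set ℓ} → A ⇀ B → A ⇀ B → Set ℓ
f ≈ₚ g = dom f ≐ dom g ×
         (∀ {a} (p : a ∈ dom f) (q : a ∈ dom g) → apply f a p ≡ apply g a q)

-- Pushouts in the category of sets at level ℓ, functions being compared
-- pointwise:
--
--   A --f--> B
--   |        |
--   g        i
--   v        v
--   C --j--> P
record IsPushout {A B C P : Set ℓ} (f : A → B) (g : A → C)
                 (i : B → P) (j : C → P) : Set (lsuc ℓ) where
  field
    commutes  : i ∘ f ≗ j ∘ g
    universal : ∀ {X : Set ℓ} (u : B → X) (v : C → X) → u ∘ f ≗ v ∘ g →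
                ∃! _≗_ λ (w : P → X) → w ∘ i ≗ u × w ∘ j ≗ v

record Signature o : Set (lsuc o) where
  field
    Symbol : Set o
    arity  : Symbol → ℕ

open Signature public

-- Graphs with set of nodes N.
record GraphOn (Ω : Signature o) (N : Set ℓ) : Set (o ⊔ lsuc ℓ) where
  field
    Labeled           : Pred N ℓ
    label             : ∀ n → .(n ∈ Labeled) → Symbol Ω
    successors        : ∀ n → .(n ∈ Labeled) → List N
    length-successors : ∀ n .(n∈ : n ∈ Labeled) →
                        length (successors n n∈) ≡ arity Ω (label n n∈)

record Graph (Ω : Signature o) ℓ : Set (o ⊔ lsuc ℓ) where
  constructor graph
  field
    Node    : Set ℓ
    graphOn : GraphOn Ω Node
  open GraphOn graphOn public

open Graph public

module _ {Ω : Signature o} where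

  infix 4 _≈ᵍ_
  _≈ᵍ_ : {N : Set ℓ} → GraphOn Ω N → GraphOn Ω N → Set (o ⊔ ℓ)
  G ≈ᵍ H = G.Labeled ≐ H.Labeled ×
           (∀ {n} (p : n ∈ G.Labeled) (q : n ∈ H.Labeled) →
              G.label n p ≡ H.label n q × G.successors n p ≡ H.successors n q)
    where
      module G = GraphOn G
      module H = GraphOn H

  module _ (G H : Graph Ω ℓ) (γ : Node G → Node H) where

    SameContents : (n : Node G) (p : Node H) →
                   n ∈ Labeled G → p ∈ Labeled H → Set (o ⊔ ℓ)
    SameContents n p n∈ p∈ =
      label H p p∈ ≡ label G n n∈ ×
      successors H p p∈ ≡ map γ (successors G n n∈)

    IsGraphMorphism : Set (o ⊔ ℓ)
    IsGraphMorphism = ∀ n (n∈ : n ∈ Labeled G) →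
                      Σ[ p∈ ∈ γ n ∈ Labeled H ] SameContents n (γ n) n∈ p∈

    Graphic : Pred (Node G) (o ⊔ ℓ)
    Graphic n =
      n ∉ Labeled G ⊎
      Σ[ n∈ ∈ n ∈ Labeled G ] Σ[ p∈ ∈ γ n ∈ Labeled H ]
        SameContents n (γ n) n∈ p∈

    StrictlyGraphic : Pred (Node G) (o ⊔ ℓ)
    StrictlyGraphic n =
      (n ∉ Labeled G × γ n ∉ Labeled H) ⊎
      Σ[ n∈ ∈ n ∈ Labeled G ] Σ[ p∈ ∈ γ n ∈ Labeled H ]
        SameContents n (γ n) n∈ p∈

    -- IsClone p q : the node p of H is a γ-clone of the node q of G.
    IsClone : Node H → Node G → Set (o ⊔ ℓ)
    IsClone p q =
      (p ∈ Labeled H ⇔ q ∈ Labeled G) ×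
      (∀ (p∈ : p ∈ Labeled H) (q∈ : q ∈ Labeled G) → SameContents q p q∈ p∈)

  infix 4 _⟶_
  record _⟶_ (G H : Graph Ω ℓ) : Set (o ⊔ ℓ) where
    constructor morphism
    field
      fun             : Node G → Node H
      isGraphMorphism : IsGraphMorphism G H fun

  open _⟶_ public

  IsRewriteRule : (L R : Graph Ω ℓ) →
                  (Node L → Node R) → (Node R ⇀ Node L) → Set (o ⊔ ℓ)
  IsRewriteRule L R τ σ =
    ∀ n (n∈ : n ∈ dom σ) → n ∉ Labeled R ⊎ IsClone L R τ n (apply σ n n∈)

record RewriteRule (Ω : Signature o) ℓ : Set (o ⊔ lsuc ℓ) where
  field
    L R           : Graph Ω ℓ
    τ             : Node L → Node R
    σ             : Node R ⇀ Node L
    isRewriteRule : IsRewriteRule L R τ σ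

module _ {Ω : Signature o} where

  record IsRuleMorphism (T T₁ : RewriteRule Ω ℓ)
                        (m : RewriteRule.L T ⟶ RewriteRule.L T₁)
                        (d : RewriteRule.R T ⟶ RewriteRule.R T₁) : Set ℓ where
    private
      module T  = RewriteRule T
      module T₁ = RewriteRule T₁
    field
      τ-commutes : fun d ∘ T.τ ≗ T₁.τ ∘ fun m
      dom-⊆      : ∀ {n} → n ∈ dom T.σ → fun d n ∈ dom T₁.σ
      σ-commutes : ∀ {n} (n∈ : n ∈ dom T.σ) →
                   fun m (apply T.σ n n∈) ≡ apply T₁.σ (fun d n) (dom-⊆ n∈)

  module _ (T : RewriteRule Ω ℓ) {G : Graph Ω ℓ} (m : RewriteRule.L T ⟶ G) where
    open RewriteRule T

    IsMatching : Set ℓ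
    IsMatching =
      ∀ {p p′} → p ≢ p′ → fun m p ≡ fun m p′ →
      Σ[ τp∈ ∈ τ p ∈ dom σ ] Σ[ τp′∈ ∈ τ p′ ∈ dom σ ]
        apply σ (τ p) τp∈ ≡ apply σ (τ p′) τp′∈

    record IsCloningCone (H : Graph Ω ℓ) (τ₁ : Node G → Node H) (d : R ⟶ H)
                         (σ₁ : Node H ⇀ Node G) : Set (o ⊔ lsuc ℓ) where
      field
        isRule : IsRewriteRule G H τ₁ σ₁

      rule : RewriteRule Ω ℓ
      rule = record { L = G ; R = H ; τ = τ₁ ; σ = σ₁ ; isRewriteRule = isRule }

      field
        isRuleMorphism : IsRuleMorphism T rule m d
        graphic        : ∁ (range (fun m)) ⊆ Graphic G H τ₁
        clones         : ∀ n₁ (n₁∈ : n₁ ∈ dom σ₁) →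
                         IsClone G H τ₁ n₁ (apply σ₁ n₁ n₁∈)

    record CloningCone : Set (o ⊔ lsuc ℓ) where
      constructor cloningCone
      field
        H             : Graph Ω ℓ
        τ₁            : Node G → Node H
        d             : R ⟶ H
        σ₁            : Node H ⇀ Node G
        isCloningCone : IsCloningCone H τ₁ d σ₁

    record ConeMorphism (C C′ : CloningCone) : Set (o ⊔ ℓ) where
      private
        module C  = CloningCone C
        module C′ = CloningCone C′
      field
        h          : C.H ⟶ C′.H
        τ-commutes : fun h ∘ C.τ₁ ≗ C′.τ₁
        d-commutes : fun h ∘ fun C.d ≗ fun C′.d
        dom-⊆      : ∀ {n} → n ∈ dom C.σ₁ → fun h n ∈ dom C′.σ₁
        σ-commutes : ∀ {n} (n∈ : n ∈ dom C.σ₁) →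
                     apply C′.σ₁ (fun h n) (dom-⊆ n∈) ≡ apply C.σ₁ n n∈

    -- Morphisms of cloning cones are equal when their functions on nodes are.
    infix 4 _≈ᶜ_
    _≈ᶜ_ : {C C′ : CloningCone} → ConeMorphism C C′ → ConeMorphism C C′ → Set ℓ
    f ≈ᶜ g = fun (ConeMorphism.h f) ≗ fun (ConeMorphism.h g)

    IsCloningPushout : CloningCone → Set (o ⊔ lsuc ℓ)
    IsCloningPushout C =
      ∀ (C′ : CloningCone) → Σ[ f ∈ ConeMorphism C C′ ] (∀ g → f ≈ᶜ g)

    module _ {𝓗 : Set ℓ} (τ₁ : Node G → 𝓗) (δ : Node R → 𝓗) where

      record IsInducedPartialFunction (σ₁ : 𝓗 ⇀ Node G) : Set ℓ where
        field
          domain   : dom σ₁ ≐ image δ (dom σ)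
          commutes : ∀ {n} (n∈ : n ∈ dom σ) (δn∈ : δ n ∈ dom σ₁) →
                     fun m (apply σ n n∈) ≡ apply σ₁ (δ n) δn∈

      record IsInducedGraph (σ₁ : 𝓗 ⇀ Node G) (H : GraphOn Ω 𝓗) :
                            Set (o ⊔ ℓ) where
        field
          τ₁-strict : ∁ (range (fun m)) ⊆ StrictlyGraphic G (graph 𝓗 H) τ₁
          δ-strict  : ∁ (dom σ) ⊆ StrictlyGraphic R (graph 𝓗 H) δ
          clones    : ∀ n₁ → n₁ ∈ image δ (dom σ) → (n₁∈ : n₁ ∈ dom σ₁) →
                      IsClone G (graph 𝓗 H) τ₁ n₁ (apply σ₁ n₁ n₁∈)

-- By the matching condition, the set function sending a node r of Δ to itself,
-- a node r of Σ to m (σ r) and a node of Γ to itself factors through the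
-- pushout.  The resulting function `source` makes σ₁ well defined, and H is the
-- graph in which every node is a clone of its source.  Conversely every node of
-- the pushout comes from Γ, Δ or Σ, and in each case it is a clone of a known
-- node of G or R; this determines H and shows that the set function out of 𝓗
-- induced by a cloning cone is a graph morphism.
module Submission where

open import Defs
open import Axiom.ExcludedMiddle using (ExcludedMiddle)
open import Data.Bool.Base using (Bool; true)
open import Data.Empty.Irrelevant using (⊥-elim)
open import Data.List.Base using (List; length; map)
open import Data.List.Properties using (length-map; map-∘; map-cong)
open import Data.Product using (Σ-syntax; ∃!; _×_; _,_; proj₁; proj₂)
open import Data.Sum.Base using (_⊎_; inj₁; inj₂)
open import Data.Sum.Properties using (inj₂-injective)
open import Function.Base using (_∘_; const)
open import Function.Bundles using (mk⇔; Equivalence)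
open import Level using (Level; Lift; lift; lower)
open import Relation.Binary.PropositionalEquality
  using (_≡_; refl; sym; trans; cong; subst; _≗_; module ≡-Reasoning)
open import Relation.Nullary using (Dec; yes; no; does; contradiction)
open import Relation.Nullary.Decidable using (dec-true)
open import Relation.Unary using (Pred; _∈_; _∉_)

open Equivalence using (to; from)

private
  variable
    o ℓ : Level

apply-cong : {A B : Set ℓ} (f : A ⇀ B) {x y : A} → x ≡ y →
             (p : x ∈ dom f) (q : y ∈ dom f) → apply f x p ≡ apply f y q
apply-cong f refl p q = refl

-- Pushouts of sets: joint surjectivity in the form of an induction principle.

module _ {A B C P : Set ℓ} {f : A → B} {g : A → C} {i : B → P} {j : C → P}
         (po : IsPushout f g i j) where
  open IsPushout po

  -- Both functions mediate for the cocone `w ∘ i`, `w ∘ j`, hence both agree with its unique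
  -- mediating function.
  pushout-jointly-epic : {X : Set ℓ} (w w′ : P → X) →
                         w ∘ i ≗ w′ ∘ i → w ∘ j ≗ w′ ∘ j → w ≗ w′
  pushout-jointly-epic w w′ eᵢ eⱼ x =
    let (_ , _ , unique) = universal (w ∘ i) (w ∘ j) (cong w ∘ commutes)
    in trans (sym (unique ((λ _ → refl) , (λ _ → refl)) x))
             (unique ((sym ∘ eᵢ) , (sym ∘ eⱼ)) x)

  -- Excluded middle turns `Q` into a truth-valued function on `P`. It agrees with the constant
  -- `true` after `i` and after `j`, hence everywhere. `Bool` is lifted because the universal
  -- property tests against sets of level `ℓ`.
  pushout-induction : ExcludedMiddle ℓ → (Q : Pred P ℓ) →
                      (∀ b → i b ∈ Q) → (∀ c → j c ∈ Q) → ∀ x → x ∈ Q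
  pushout-induction em Q Qi Qj x = decided em (cong lower (sym (true≗ x)))
    where
    decide : P → Lift ℓ Bool
    decide y = lift (does (em {y ∈ Q}))

    true≗ : const (lift true) ≗ decide
    true≗ = pushout-jointly-epic _ decide
      (λ b → cong lift (sym (dec-true em (Qi b))))
      (λ c → cong lift (sym (dec-true em (Qj c))))

    decided : (q : Dec (x ∈ Q)) → does q ≡ true → x ∈ Q
    decided (yes q) _ = q
    decided (no _) ()

-- Clones, graphic functions and contents of nodes.

module _ {Ω : Signature o} where

  -- Being a clone is an equivalence of labeledness, being strictly graphic a disjunction; the
  -- decision selects the disjunct.
  clone⇒strictlyGraphic : (K H : Graph Ω ℓ) (γ : Node K → Node H) {n : Node K} →
    Dec (n ∈ Labeled K) → IsClone K H γ (γ n) n → StrictlyGraphic K H γ n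
  clone⇒strictlyGraphic K H γ (yes n∈) (labeled , same) =
    inj₂ (n∈ , from labeled n∈ , same (from labeled n∈) n∈)
  clone⇒strictlyGraphic K H γ (no n∉) (labeled , _) = inj₁ (n∉ , n∉ ∘ to labeled)

  strictlyGraphic⇒clone : (K H : Graph Ω ℓ) (γ : Node K → Node H) {n : Node K} →
    StrictlyGraphic K H γ n → IsClone K H γ (γ n) n
  strictlyGraphic⇒clone K H γ (inj₁ (n∉ , p∉)) =
    mk⇔ (λ p∈ → contradiction p∈ p∉) (λ n∈ → contradiction n∈ n∉) ,
    λ p∈ → contradiction p∈ p∉
  strictlyGraphic⇒clone K H γ (inj₂ (n∈ , p∈ , same)) =
    mk⇔ (const n∈) (const p∈) , λ _ _ → same

  strictlyGraphic⇒graphic : (K H : Graph Ω ℓ) (γ : Node K → Node H) {n : Node K} →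
    StrictlyGraphic K H γ n → Graphic K H γ n
  strictlyGraphic⇒graphic K H γ (inj₁ (n∉ , _)) = inj₁ n∉
  strictlyGraphic⇒graphic K H γ (inj₂ contents)  = inj₂ contents

  graphic⇒contents : (K H : Graph Ω ℓ) (γ : Node K → Node H) {n : Node K} →
    Graphic K H γ n → (n∈ : n ∈ Labeled K) →
    Σ[ p∈ ∈ γ n ∈ Labeled H ] SameContents K H γ n (γ n) n∈ p∈
  graphic⇒contents K H γ (inj₁ n∉)                n∈ = contradiction n∈ n∉
  graphic⇒contents K H γ (inj₂ (_ , p∈ , same)) _  = p∈ , same

  clone⇒contents : (K H : Graph Ω ℓ) (γ : Node K → Node H) {p : Node H} {q : Node K} →
    IsClone K H γ p q → (q∈ : q ∈ Labeled K) →
    Σ[ p∈ ∈ p ∈ Labeled H ] SameContents K H γ q p q∈ p∈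
  clone⇒contents K H γ (labeled , same) q∈ = from labeled q∈ , same (from labeled q∈) q∈

  module _ (K : Graph Ω ℓ) {N : Set ℓ} (γ : Node K → N) (H H′ : GraphOn Ω N) where
    private
      module H  = GraphOn H
      module H′ = GraphOn H′

    clones-labeled : ∀ {p q} →
      IsClone K (graph N H) γ p q → IsClone K (graph N H′) γ p q →
      p ∈ H.Labeled → p ∈ H′.Labeled
    clones-labeled (labeled , _) (labeled′ , _) = from labeled′ ∘ to labeled

    clones-agree : ∀ {p q} →
      IsClone K (graph N H) γ p q → IsClone K (graph N H′) γ p q →
      (p∈ : p ∈ H.Labeled) (p∈′ : p ∈ H′.Labeled) →
      H.label p p∈ ≡ H′.label p p∈′ × H.successors p p∈ ≡ H′.successors p p∈′
    clones-agree (labeled , same) (_ , same′) p∈ p∈′ =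
      let q∈            = to labeled p∈
          (l  , s)  = same  p∈  q∈
          (l′ , s′) = same′ p∈′ q∈
      in trans l (sym l′) , trans s (sym s′)

  -- A function h on nodes preserves the contents of a clone x of q as soon as h x
  -- has the contents of q.
  clone-contents : (K H H′ : Graph Ω ℓ) (γ : Node K → Node H) (γ′ : Node K → Node H′)
    (h : Node H → Node H′) → h ∘ γ ≗ γ′ →
    ∀ {x q y} → h x ≡ y → IsClone K H γ x q →
    ((q∈ : q ∈ Labeled K) → Σ[ y∈ ∈ y ∈ Labeled H′ ] SameContents K H′ γ′ q y q∈ y∈) →
    (x∈ : x ∈ Labeled H) → Σ[ hx∈ ∈ h x ∈ Labeled H′ ] SameContents H H′ h x (h x) x∈ hx∈
  clone-contents K H H′ γ γ′ h hγ {x} {q} refl (labeled , same) contents x∈ =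
    let q∈                = to labeled x∈
        (l , s)           = same x∈ q∈
        (hx∈ , l′ , s′) = contents q∈
    in hx∈ , trans l′ (sym l) , (begin
      successors H′ (h x) hx∈             ≡⟨ s′ ⟩
      map γ′ (successors K q q∈)          ≡⟨ map-cong hγ _ ⟨
      map (h ∘ γ) (successors K q q∈)     ≡⟨ map-∘ _ ⟩
      map h (map γ (successors K q q∈))   ≡⟨ cong (map h) s ⟨
      map h (successors H x x∈)           ∎)
    where open ≡-Reasoning

  -- The graph in which every node copies a prescribed source.

  module SourceGraph (R G : Graph Ω ℓ) {N : Set ℓ} (δ : Node R → N) (τ : Node G → N)
                     (source : N → Node R ⊎ Node G) where

    private
      Labeledˢ : Pred (Node R ⊎ Node G) ℓ
      Labeledˢ (inj₁ r) = r ∈ Labeled R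
      Labeledˢ (inj₂ g) = g ∈ Labeled G

      labelˢ : ∀ s → .(s ∈ Labeledˢ) → Symbol Ω
      labelˢ (inj₁ r) = label R r
      labelˢ (inj₂ g) = label G g

      successorsˢ : ∀ s → .(s ∈ Labeledˢ) → List N
      successorsˢ (inj₁ r) r∈ = map δ (successors R r r∈)
      successorsˢ (inj₂ g) g∈ = map τ (successors G g g∈)

      length-successorsˢ : ∀ s .(s∈ : s ∈ Labeledˢ) →
                           length (successorsˢ s s∈) ≡ arity Ω (labelˢ s s∈)
      length-successorsˢ (inj₁ r) r∈ = trans (length-map δ (successors R r r∈))
                                           (length-successors R r r∈)
      length-successorsˢ (inj₂ g) g∈ = trans (length-map τ (successors G g g∈))
                                           (length-successors G g g∈)

    sourceGraph : GraphOn Ω N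
    sourceGraph = record
      { Labeled           = Labeledˢ ∘ source
      ; label             = labelˢ ∘ source
      ; successors        = successorsˢ ∘ source
      ; length-successors = length-successorsˢ ∘ source
      }

    -- Once `source x` is abstracted to the known source, the fields of `sourceGraph` at `x` reduce
    -- and the clone equations are definitional.
    source-clone₁ : ∀ {x r} → source x ≡ inj₁ r → IsClone R (graph N sourceGraph) δ x r
    source-clone₁ {x} e with source x
    source-clone₁ refl | _ = mk⇔ (λ p → p) (λ p → p) , λ _ _ → refl , refl

    source-clone₂ : ∀ {x g} → source x ≡ inj₂ g → IsClone G (graph N sourceGraph) τ x g
    source-clone₂ {x} e with source x
    source-clone₂ refl | _ = mk⇔ (λ p → p) (λ p → p) , λ _ _ → refl , refl

-- Origins of the nodes of the pushout.

module CloningPushout (em : ExcludedMiddle ℓ) {Ω : Signature o} (T : RewriteRule Ω ℓ)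
  {G : Graph Ω ℓ} (m : RewriteRule.L T ⟶ G) {𝓗 : Set ℓ} {τ₁ : Node G → 𝓗}
  {δ : Node (RewriteRule.R T) → 𝓗} (po : IsPushout (RewriteRule.τ T) (fun m) δ τ₁) where

  open RewriteRule T
  open IsPushout po

  -- Only a cover of `𝓗` is recorded: a node may arise from several elements of Σ.
  data Origin : Pred 𝓗 ℓ where
    fromΓ : ∀ {g} → g ∉ range (fun m) → Origin (τ₁ g)
    fromΔ : ∀ {r} → r ∉ dom σ → Origin (δ r)
    fromΣ : ∀ {r} → r ∈ dom σ → Origin (δ r)

  origin : ∀ x → Origin x
  origin = pushout-induction po em Origin origin-δ origin-τ₁
    where
    origin-δ : ∀ r → Origin (δ r)
    origin-δ r with em {r ∈ dom σ}
    ... | yes r∈ = fromΣ r∈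
    ... | no  r∉ = fromΔ r∉

    origin-τ₁ : ∀ g → Origin (τ₁ g)
    origin-τ₁ g with em {g ∈ range (fun m)}
    -- The node `τ₁ (m p)` is `δ (τ p)`, so it is classified from the side of `R`.
    ... | yes (p , refl) = subst Origin (commutes p) (origin-δ (τ p))
    ... | no  g∉         = fromΓ g∉

  -- Existence of the induced partial function and of the induced graph.

  module Source (matching : IsMatching T m) where

    private
      sourceʳ : (r : Node R) → Dec (r ∈ dom σ) → Node R ⊎ Node G
      sourceʳ r (yes r∈) = inj₂ (fun m (apply σ r r∈))
      sourceʳ r (no _)   = inj₁ r

      sourceᵍ : (g : Node G) → Dec (g ∈ range (fun m)) → Node R ⊎ Node G
      -- The source is computed through whichever preimage `p` of `g` the decision supplies;
      -- `compatible` shows that the choice is immaterial.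
      sourceᵍ g (yes (p , _)) = sourceʳ (τ p) em
      sourceᵍ g (no _)        = inj₂ g

      sourceʳ-Σ : ∀ {r} (r∈ : r ∈ dom σ) r∈? → sourceʳ r r∈? ≡ inj₂ (fun m (apply σ r r∈))
      sourceʳ-Σ r∈ (yes _) = refl
      sourceʳ-Σ r∈ (no r∉) = contradiction r∈ r∉

      sourceʳ-Δ : ∀ {r} → r ∉ dom σ → ∀ r∈? → sourceʳ r r∈? ≡ inj₁ r
      sourceʳ-Δ r∉ (yes r∈) = contradiction r∈ r∉
      sourceʳ-Δ r∉ (no _)   = refl

      sourceᵍ-Γ : ∀ {g} → g ∉ range (fun m) → ∀ g∈? → sourceᵍ g g∈? ≡ inj₂ g
      sourceᵍ-Γ g∉ (yes g∈) = contradiction g∈ g∉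
      sourceᵍ-Γ g∉ (no _)   = refl

      -- If the supplied preimage differs from `p`, the matching condition puts both images under
      -- `τ` in the domain of `σ` with equal values, so the sources coincide.
      compatible : ∀ p g∈? → sourceʳ (τ p) em ≡ sourceᵍ (fun m p) g∈?
      compatible p (no ∉) = contradiction (p , refl) ∉
      compatible p (yes (p′ , mp′≡mp)) with em {p ≡ p′}
      ... | yes refl = refl
      ... | no p≢p′ =
        let (τp∈ , τp′∈ , e) = matching p≢p′ (sym mp′≡mp)
        in trans (sourceʳ-Σ τp∈ em)
             (trans (cong (inj₂ ∘ fun m) e) (sym (sourceʳ-Σ τp′∈ em)))

      factorization = universal (λ r → sourceʳ r em) (λ g → sourceᵍ g em)
                                (λ p → compatible p em)

    source : 𝓗 → Node R ⊎ Node G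
    source = proj₁ factorization

    source-Σ : ∀ {r} (r∈ : r ∈ dom σ) → source (δ r) ≡ inj₂ (fun m (apply σ r r∈))
    source-Σ r∈ = trans (proj₁ (proj₁ (proj₂ factorization)) _) (sourceʳ-Σ r∈ em)

    source-Δ : ∀ {r} → r ∉ dom σ → source (δ r) ≡ inj₁ r
    source-Δ r∉ = trans (proj₁ (proj₁ (proj₂ factorization)) _) (sourceʳ-Δ r∉ em)

    source-Γ : ∀ {g} → g ∉ range (fun m) → source (τ₁ g) ≡ inj₂ g
    source-Γ g∉ = trans (proj₂ (proj₁ (proj₂ factorization)) _) (sourceᵍ-Γ g∉ em)

    -- This makes `σ₁` well defined: the value `m (σ r)` can be recovered from the node `δ r` alone,
    -- as its source.
    mσ-cong : ∀ {r r′} (r∈ : r ∈ dom σ) (r′∈ : r′ ∈ dom σ) → δ r ≡ δ r′ →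
              fun m (apply σ r r∈) ≡ fun m (apply σ r′ r′∈)
    mσ-cong r∈ r′∈ e = inj₂-injective
      (trans (sym (source-Σ r∈)) (trans (cong source e) (source-Σ r′∈)))

    -- The value is read off a preimage recomputed by excluded middle, since the
    -- given membership proof is irrelevant.
    inducedPartialFunction : 𝓗 ⇀ Node G
    inducedPartialFunction = record
      { dom   = image δ (dom σ)
      ; apply = λ x x∈ → value em x∈
      }
      where
      value : ∀ {x} → Dec (x ∈ image δ (dom σ)) → .(x ∈ image δ (dom σ)) → Node G
      value (yes (r , r∈ , _)) _  = fun m (apply σ r r∈)
      value (no x∉)            x∈ = ⊥-elim (x∉ x∈)

    inducedPartialFunction-isInduced :
      IsInducedPartialFunction T m τ₁ δ inducedPartialFunction
    inducedPartialFunction-isInduced = record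
      { domain   = (λ x∈ → x∈) , (λ x∈ → x∈)
      ; commutes = mσ≡
      }
      where
      mσ≡ : ∀ {r} (r∈ : r ∈ dom σ) (δr∈ : δ r ∈ image δ (dom σ)) →
            fun m (apply σ r r∈) ≡ apply inducedPartialFunction (δ r) δr∈
      mσ≡ {r} r∈ δr∈ with em {δ r ∈ image δ (dom σ)}
      -- The recomputed preimage `r′` need not be `r`.
      ... | yes (r′ , r′∈ , e) = mσ-cong r∈ r′∈ (sym e)
      ... | no δr∉             = contradiction δr∈ δr∉

    open SourceGraph R G δ τ₁ source public

    -- All three requirements say that a node is a clone of its source; over Σ the source is the
    -- value of `σ₁`, by commutation.
    sourceGraph-isInduced : ∀ {σ₁} → IsInducedPartialFunction T m τ₁ δ σ₁ →
                            IsInducedGraph T m τ₁ δ σ₁ sourceGraph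
    sourceGraph-isInduced {σ₁} σ₁-induced = record
      { τ₁-strict = λ g∉ →
          clone⇒strictlyGraphic G H τ₁ em (source-clone₂ (source-Γ g∉))
      ; δ-strict  = λ r∉ →
          clone⇒strictlyGraphic R H δ em (source-clone₁ (source-Δ r∉))
      ; clones    = λ { _ (_ , r∈ , refl) δr∈ → source-clone₂
          (trans (source-Σ r∈)
                 (cong inj₂ (IsInducedPartialFunction.commutes σ₁-induced r∈ δr∈))) }
      }
      where
      H = graph 𝓗 sourceGraph

  inducedPartialFunction-unique : ∀ {σ₁ σ₁′} →
    IsInducedPartialFunction T m τ₁ δ σ₁ → IsInducedPartialFunction T m τ₁ δ σ₁′ →
    σ₁ ≈ₚ σ₁′
  inducedPartialFunction-unique {σ₁} {σ₁′} i i′ =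
    ((λ x∈ → proj₂ I′.domain (proj₁ I.domain x∈)) ,
     (λ x∈ → proj₂ I.domain (proj₁ I′.domain x∈))) ,
    λ x∈ → agree (proj₁ I.domain x∈) x∈
    where
    module I  = IsInducedPartialFunction i
    module I′ = IsInducedPartialFunction i′

    agree : ∀ {x} → x ∈ image δ (dom σ) → (x∈ : x ∈ dom σ₁) (x∈′ : x ∈ dom σ₁′) →
            apply σ₁ x x∈ ≡ apply σ₁′ x x∈′
    agree (_ , r∈ , refl) x∈ x∈′ = trans (sym (I.commutes r∈ x∈)) (I′.commutes r∈ x∈′)

  module _ {σ₁ : 𝓗 ⇀ Node G} (σ₁-induced : IsInducedPartialFunction T m τ₁ δ σ₁) where
    private
      module σ₁ = IsInducedPartialFunction σ₁-induced

    δ-dom : ∀ {r} → r ∈ dom σ → δ r ∈ dom σ₁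
    δ-dom r∈ = proj₂ σ₁.domain (_ , r∈ , refl)

    -- The cloning cone on an induced graph.

    module Induced {H : GraphOn Ω 𝓗} (H-induced : IsInducedGraph T m τ₁ δ σ₁ H) where
      private
        module H = IsInducedGraph H-induced
        Ĥ = graph 𝓗 H

      Γ-clone : ∀ {g} → g ∉ range (fun m) → IsClone G Ĥ τ₁ (τ₁ g) g
      Γ-clone g∉ = strictlyGraphic⇒clone G Ĥ τ₁ (H.τ₁-strict g∉)

      Δ-clone : ∀ {r} → r ∉ dom σ → IsClone R Ĥ δ (δ r) r
      Δ-clone r∉ = strictlyGraphic⇒clone R Ĥ δ (H.δ-strict r∉)

      Σ-clone : ∀ {r} (r∈ : r ∈ dom σ) → IsClone G Ĥ τ₁ (δ r) (fun m (apply σ r r∈))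
      Σ-clone r∈ = subst (IsClone G Ĥ τ₁ _) (sym (σ₁.commutes r∈ (δ-dom r∈)))
                         (H.clones _ (_ , r∈ , refl) (δ-dom r∈))

      σ₁-clone : ∀ x (x∈ : x ∈ dom σ₁) → IsClone G Ĥ τ₁ x (apply σ₁ x x∈)
      σ₁-clone x x∈ = H.clones x (proj₁ σ₁.domain x∈) x∈

      -- Over Δ strictness suffices. Over Σ a labeled `r` is a `τ`-clone of `σ r`, whose contents
      -- `m` carries to `m (σ r)` and `τ₁` then to `δ r`; since `δ ∘ τ` equals `τ₁ ∘ m`, these are
      -- the contents of `r` mapped by `δ`.
      δ-isGraphMorphism : IsGraphMorphism R Ĥ δ
      δ-isGraphMorphism r r∈ᴸ with em {r ∈ dom σ}
      ... | no r∉ = clone⇒contents R Ĥ δ (Δ-clone r∉) r∈ᴸ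
      ... | yes r∈ with isRewriteRule r r∈
      ...   | inj₁ r∉ᴸ   = contradiction r∈ᴸ r∉ᴸ
      ...   | inj₂ clone =
        clone-contents L R Ĥ τ (τ₁ ∘ fun m) δ commutes refl clone contents r∈ᴸ
        where
        s = apply σ r r∈

        contents : (s∈ : s ∈ Labeled L) → Σ[ δr∈ ∈ δ r ∈ Labeled Ĥ ]
                   SameContents L Ĥ (τ₁ ∘ fun m) s (δ r) s∈ δr∈
        contents s∈ =
          let (ms∈ , l , e)    = isGraphMorphism m s s∈
              (δr∈ , l′ , e′) = clone⇒contents G Ĥ τ₁ (Σ-clone r∈) ms∈
          in δr∈ , trans l′ l , trans e′ (trans (cong (map τ₁) e) (sym (map-∘ _)))

      δ-morphism : R ⟶ Ĥ
      δ-morphism = morphism δ δ-isGraphMorphism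

      isCloningCone : IsCloningCone T m Ĥ τ₁ δ-morphism σ₁
      isCloningCone = record
        { isRule         = λ x x∈ → inj₂ (σ₁-clone x x∈)
        ; isRuleMorphism = record
          { τ-commutes = commutes
          ; dom-⊆      = δ-dom
          ; σ-commutes = λ r∈ → σ₁.commutes r∈ (δ-dom r∈)
          }
        ; graphic        = λ g∉ → strictlyGraphic⇒graphic G Ĥ τ₁ (H.τ₁-strict g∉)
        ; clones         = σ₁-clone
        }

      cone : CloningCone T m
      cone = cloningCone Ĥ τ₁ δ-morphism σ₁ isCloningCone

      -- Initiality of the cone.

      module Mediating (C : CloningCone T m) where
        private
          module C  = CloningCone C
          module CC = IsCloningCone C.isCloningCone
          module CR = IsRuleMorphism CC.isRuleMorphism

          factorization = universal (fun C.d) C.τ₁ CR.τ-commutes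

          h : 𝓗 → Node C.H
          h = proj₁ factorization

          h∘δ : h ∘ δ ≗ fun C.d
          h∘δ = proj₁ (proj₁ (proj₂ factorization))

          h∘τ₁ : h ∘ τ₁ ≗ C.τ₁
          h∘τ₁ = proj₂ (proj₁ (proj₂ factorization))

        -- By its origin, `x` is a clone of a known node, and `h x` has the contents of that node:
        -- over Γ since the cone is graphic there, over Δ since its `d` is a morphism, over Σ by its
        -- clone condition.
        h-isGraphMorphism : IsGraphMorphism Ĥ C.H h
        h-isGraphMorphism x = go (origin x)
          where
          go : ∀ {x} → Origin x → (x∈ : x ∈ Labeled Ĥ) →
               Σ[ hx∈ ∈ h x ∈ Labeled C.H ] SameContents Ĥ C.H h x (h x) x∈ hx∈
          go (fromΓ {g} g∉) =
            clone-contents G Ĥ C.H τ₁ C.τ₁ h h∘τ₁ (h∘τ₁ g) (Γ-clone g∉)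
              (graphic⇒contents G C.H C.τ₁ (CC.graphic g∉))
          go (fromΔ {r} r∉) =
            clone-contents R Ĥ C.H δ (fun C.d) h h∘δ (h∘δ r) (Δ-clone r∉)
              (isGraphMorphism C.d r)
          go (fromΣ {r} r∈) =
            clone-contents G Ĥ C.H τ₁ C.τ₁ h h∘τ₁ (h∘δ r) (Σ-clone r∈)
              (clone⇒contents G C.H C.τ₁
                -- The clone condition concerns the value of `C.σ₁` at `d r`, which the rule
                -- morphism identifies with `m (σ r)`.
                (subst (IsClone G C.H C.τ₁ _) (sym (CR.σ-commutes r∈))
                       (CC.clones _ (CR.dom-⊆ r∈))))

        h-dom : ∀ {x} → x ∈ dom σ₁ → h x ∈ dom C.σ₁
        h-dom x∈ with proj₁ σ₁.domain x∈
        ... | r , r∈ , refl = subst (dom C.σ₁) (sym (h∘δ r)) (CR.dom-⊆ r∈)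

        -- Writing `x` as `δ r` with `r` in Σ, both sides equal `m (σ r)`.
        h-σ₁ : ∀ {x} (x∈ : x ∈ dom σ₁) (hx∈ : h x ∈ dom C.σ₁) →
               apply C.σ₁ (h x) hx∈ ≡ apply σ₁ x x∈
        h-σ₁ x∈ hx∈ with proj₁ σ₁.domain x∈
        ... | r , r∈ , refl =
          trans (apply-cong C.σ₁ (h∘δ r) hx∈ (CR.dom-⊆ r∈))
                (trans (sym (CR.σ-commutes r∈)) (σ₁.commutes r∈ x∈))

        mediating : ConeMorphism T m cone C
        mediating = record
          { h          = morphism h h-isGraphMorphism
          ; τ-commutes = h∘τ₁
          ; d-commutes = h∘δ
          ; dom-⊆      = h-dom
          ; σ-commutes = λ x∈ → h-σ₁ x∈ (h-dom x∈)
          }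

        -- Cone morphisms are compared on nodes only, so uniqueness is that of the pushout of sets.
        mediating-unique : (f : ConeMorphism T m cone C) →
                           h ≗ fun (ConeMorphism.h f)
        mediating-unique f =
          proj₂ (proj₂ factorization)
            (ConeMorphism.d-commutes f , ConeMorphism.τ-commutes f)

      isCloningPushout : IsCloningPushout T m cone
      isCloningPushout C = mediating , mediating-unique
        where open Mediating C

    -- Uniqueness of the induced graph.

    inducedGraphs-labeled : ∀ {H H′} → IsInducedGraph T m τ₁ δ σ₁ H →
      IsInducedGraph T m τ₁ δ σ₁ H′ → ∀ {x} → Origin x →
      x ∈ GraphOn.Labeled H → x ∈ GraphOn.Labeled H′
    inducedGraphs-labeled {H} {H′} i i′ = λ where
        (fromΓ g∉) → clones-labeled G τ₁ H H′ (I.Γ-clone g∉) (I′.Γ-clone g∉)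
        (fromΔ r∉) → clones-labeled R δ H H′ (I.Δ-clone r∉) (I′.Δ-clone r∉)
        (fromΣ r∈) → clones-labeled G τ₁ H H′ (I.Σ-clone r∈) (I′.Σ-clone r∈)
      where
      module I  = Induced i
      module I′ = Induced i′

    -- An origin of a node makes it, in both graphs, a clone of the same node along the same
    -- function, which dictates its contents.
    inducedGraph-unique : ∀ {H H′} →
      IsInducedGraph T m τ₁ δ σ₁ H → IsInducedGraph T m τ₁ δ σ₁ H′ → H ≈ᵍ H′
    inducedGraph-unique {H} {H′} i i′ =
      ((λ {x} → inducedGraphs-labeled i i′ (origin x)) ,
       (λ {x} → inducedGraphs-labeled i′ i (origin x))) ,
      λ {x} → agree (origin x)
      where
      module I  = Induced i
      module I′ = Induced i′

      agree : ∀ {x} → Origin x →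
              (x∈ : x ∈ GraphOn.Labeled H) (x∈′ : x ∈ GraphOn.Labeled H′) →
              GraphOn.label H x x∈ ≡ GraphOn.label H′ x x∈′ ×
              GraphOn.successors H x x∈ ≡ GraphOn.successors H′ x x∈′
      agree (fromΓ g∉) = clones-agree G τ₁ H H′ (I.Γ-clone g∉) (I′.Γ-clone g∉)
      agree (fromΔ r∉) = clones-agree R δ H H′ (I.Δ-clone r∉) (I′.Δ-clone r∉)
      agree (fromΣ r∈) = clones-agree G τ₁ H H′ (I.Σ-clone r∈) (I′.Σ-clone r∈)

theorem1 : ∀ {o ℓ} → ExcludedMiddle ℓ →
    (Ω : Signature o) (T : RewriteRule Ω ℓ) (G : Graph Ω ℓ) →
    let open RewriteRule T in
    (m : L ⟶ G) → IsMatching T m →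
    (𝓗 : Set ℓ) (τ₁ : Node G → 𝓗) (δ : Node R → 𝓗) →
    IsPushout τ (fun m) δ τ₁ →
    ∃! _≈ₚ_ (IsInducedPartialFunction T m τ₁ δ) ×
    (∀ σ₁ → IsInducedPartialFunction T m τ₁ δ σ₁ →
      ∃! _≈ᵍ_ (IsInducedGraph T m τ₁ δ σ₁) ×
      (∀ H → IsInducedGraph T m τ₁ δ σ₁ H →
        Σ[ δ-morphism ∈ IsGraphMorphism R (graph 𝓗 H) δ ]
        Σ[ cone ∈ IsCloningCone T m (graph 𝓗 H) τ₁ (morphism δ δ-morphism) σ₁ ]
          IsCloningPushout T m
            (cloningCone (graph 𝓗 H) τ₁ (morphism δ δ-morphism) σ₁ cone)))
theorem1 em Ω T G m matching 𝓗 τ₁ δ po =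
  ( inducedPartialFunction , inducedPartialFunction-isInduced ,
    inducedPartialFunction-unique inducedPartialFunction-isInduced ) ,
  λ σ₁ σ₁-induced →
    ( sourceGraph , sourceGraph-isInduced σ₁-induced ,
      inducedGraph-unique σ₁-induced (sourceGraph-isInduced σ₁-induced) ) ,
    λ H H-induced → let open Induced σ₁-induced H-induced in
      δ-isGraphMorphism , isCloningCone , isCloningPushout
  where
  open CloningPushout em T m po
  open Source matching
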